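{- Let $a\ge 2$, $c>0$, $d$ be integers with $d<ca$ and $\gcd(d,a)=\gcd(d,c)=1$. For each integer $n\ge 1$ let $S_n=\langle\{ca^{n+j}-d:j\in\mathbb N\}\rangle$. Then for all $n\ge 1$ we have $e(S_n)\ge n$.
   Context: $\mathbb N=\{0,1,2,\ldots\}$. For $A\subseteq\mathbb N$, $\langle A\rangle$ is the submonoid of $(\mathbb N,+)$ generated by $A$. For a nontrivial submonoid $M$ of $\mathbb N$, the minimal generating set of $M$ is the unique generating set contained in every generating set of $M$ (its elements are the nonzero elements of $M$ that are not sums of two nonzero elements of $M$; it is finite), and $e(M)$ is its cardinality. -}

module Defs where

open import Data.Integer.Base as ℤ using (ℤ; +_)
open import Data.List.Base using (List; length)
open import Data.List.Membership.Propositional using (_∈_)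
open import Data.List.Membership.Propositional.Properties.WithK using (unique∧set⇒bag)
open import Data.List.Relation.Binary.BagAndSetEquality using (∼bag⇒↭)
open import Data.List.Relation.Binary.Permutation.Propositional.Properties using (↭-length)
open import Data.List.Relation.Unary.Unique.Propositional using (Unique)
open import Data.Nat.Base using (ℕ; _+_)
open import Data.Product.Base using (∃-syntax; _×_; _,_)
open import Function.Base using (_∘_)
open import Function.Bundles using (mk⇔)
open import Level using (0ℓ; suc)
open import Relation.Binary.PropositionalEquality using (_≡_; refl)
open import Relation.Unary using (Pred; _⊆_; _≐_)

data ⟨_⟩ (A : Pred ℕ 0ℓ) : Pred ℕ 0ℓ where
  gen  : ∀ {x} → A x → ⟨ A ⟩ x
  zero : ⟨ A ⟩ 0
  add  : ∀ {x y} → ⟨ A ⟩ x → ⟨ A ⟩ y → ⟨ A ⟩ (x + y)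

_Generates_ : Pred ℕ 0ℓ → Pred ℕ 0ℓ → Set
A Generates M = ⟨ A ⟩ ≐ M

_IsMinimalGeneratingSetOf_ : Pred ℕ 0ℓ → Pred ℕ 0ℓ → Set (suc 0ℓ)
G IsMinimalGeneratingSetOf M =
  G Generates M × (∀ (A : Pred ℕ 0ℓ) → A Generates M → G ⊆ A)

HasCardinality : Pred ℕ 0ℓ → ℕ → Set
HasCardinality G k = ∃[ xs ] Unique xs × (_∈ xs) ≐ G × length xs ≡ k

-- "e(M) exists and equals k".  This is a relation because the minimal
-- generating set of an arbitrary submonoid cannot be listed constructively;
-- it is single-valued by e-unique below.
e[_]≡_ : Pred ℕ 0ℓ → ℕ → Set (suc 0ℓ)
e[ M ]≡ k = ∃[ G ] G IsMinimalGeneratingSetOf M × HasCardinality G k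

e-unique : ∀ {M k l} → e[ M ]≡ k → e[ M ]≡ l → k ≡ l
e-unique (G , (genG , minG) , xs , uxs , (xs⊆G , G⊆xs) , refl)
         (H , (genH , minH) , ys , uys , (ys⊆H , H⊆ys) , refl) =
  ↭-length (∼bag⇒↭ (unique∧set⇒bag uxs uys
    (mk⇔ (H⊆ys ∘ minG H genH ∘ xs⊆G) (G⊆xs ∘ minH G genG ∘ ys⊆H))))

-- The set { c a^(n+j) - d : j ∈ ℕ } intersected with ℕ.  For a ≥ 2, c > 0,
-- d < ca and n ≥ 1 every c a^(n+j) - d is positive, so nothing is discarded.
generators : (a c d : ℤ) → ℕ → Pred ℕ 0ℓ
generators a c d n x = ∃[ j ] + x ≡ c ℤ.* a ℤ.^ (n + j) ℤ.- d

S : (a c d : ℤ) → ℕ → Pred ℕ 0ℓ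
S a c d n = ⟨ generators a c d n ⟩

{-# OPTIONS --safe #-}

-- Write s j = c aⁿ⁺ʲ − d and E = c aⁿ, and call j reducible when s j − s i ∈ Sₙ
-- for some i < j.  The recurrence s (k+1) − a (s k) = (a−1) d shows that
-- s j = s i + y implies s (j+1) = s (i+1) + a y, so reducibility is upward closed;
-- by the pigeonhole principle modulo s 0 some index is reducible.  Hence the
-- minimal generating set is { s j : j < p } with p the least reducible index.
-- If s p = s i + y with y a sum of L generators, then E divides L d, hence
-- E ∣ L and E ≤ L.  So s p ≥ (1 + E) (s 0), that is aᵖ ≥ 1 + s 0, and
-- s 0 ≥ aⁿ⁻¹ because d < c a; hence p ≥ n.
module Submission where

open import Defs
open import Data.Fin.Base using (Fin; toℕ)
open import Data.Fin.Properties using (pigeonhole; toℕ-fromℕ<)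
open import Data.Integer using (ℤ; +_; 0ℤ; 1ℤ; _*_; _<_) renaming (_≤_ to _≤ℤ_)
import Data.Integer as ℤ
import Data.Integer.Coprimality as ℤ
open import Data.Integer.GCD using (gcd)
import Data.Integer.Properties as ℤ
import Data.Integer.Tactic.RingSolver as ℤ-Solver
open import Data.List.Base using (applyUpTo)
open import Data.List.Membership.Propositional.Properties using (∈-applyUpTo⁺; ∈-applyUpTo⁻)
open import Data.List.Properties using (length-applyUpTo)
open import Data.List.Relation.Unary.Unique.Propositional.Properties using (applyUpTo⁺₁)
open import Data.Nat using (ℕ; _≤_; suc; _∸_; _^_; NonZero; s≤s; z≤n; s<s; >-nonZero; _≤?_; _≟_)
import Data.Nat as ℕ
open import Data.Nat.Coprimality as Coprimality using (Coprime; coprime-divisor; gcd≡1⇒coprime)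
open import Data.Nat.Divisibility using (_∣_; divides; ∣-trans; ∣1⇒≡1; ∣⇒≤)
open import Data.Nat.DivMod using (_/_; _%_; _mod_; m%n<n; m≡m%n+[m/n]*n)
open import Data.Nat.Induction using (<-rec; <-wellFounded; Acc; acc)
open import Data.Nat.Properties
import Data.Nat.Tactic.RingSolver as ℕ-Solver
open import Data.Product using (∃-syntax; _×_; _,_; proj₁; proj₂; map₂)
open import Data.Sum using (_⊎_; inj₁; inj₂)
open import Function.Base using (_∘_)
open import Level using (0ℓ)
open import Relation.Binary.PropositionalEquality
  using (_≡_; _≢_; refl; sym; trans; cong; cong₂; subst; module ≡-Reasoning)
open import Relation.Nullary using (¬_; Dec; yes; no; contradiction)
open import Relation.Nullary.Decidable using (map′; _⊎-dec_)
open import Relation.Unary using (Pred; Decidable; _⊆_)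

-- Auxiliary facts on divisibility, coprimality and generated submonoids.

least : ∀ {P : Pred ℕ 0ℓ} → Decidable P → ∀ {n} → P n →
        ∃[ p ] P p × (∀ i → i ℕ.< p → ¬ P i)
least {P} P? {n} = <-rec (λ n → P n → ∃[ p ] P p × (∀ i → i ℕ.< p → ¬ P i)) step n
  where
  step : ∀ n → (∀ {i} → i ℕ.< n → P i → _) → P n → _
  step n rec Pn with anyUpTo? P? n
  ... | yes (i , i<n , Pi) = rec i<n Pi
  ... | no none            = n , Pn , λ i i<n Pi → none (i , i<n , Pi)

%-≡⇒∸-multiple : ∀ m n o .{{_ : NonZero o}} → m % o ≡ n % o →
                 n ∸ m ≡ (n / o ∸ m / o) ℕ.* o
%-≡⇒∸-multiple m n o eq = begin
  n ∸ m                                                  ≡⟨ cong₂ _∸_ (m≡m%n+[m/n]*n n o) (m≡m%n+[m/n]*n m o) ⟩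
  (n % o ℕ.+ n / o ℕ.* o) ∸ (m % o ℕ.+ m / o ℕ.* o)      ≡⟨ cong (λ r → (n % o ℕ.+ n / o ℕ.* o) ∸ (r ℕ.+ m / o ℕ.* o)) eq ⟩
  (n % o ℕ.+ n / o ℕ.* o) ∸ (n % o ℕ.+ m / o ℕ.* o)      ≡⟨ [m+n]∸[m+o]≡n∸o (n % o) _ _ ⟩
  n / o ℕ.* o ∸ m / o ℕ.* o                              ≡⟨ *-distribʳ-∸ o (n / o) (m / o) ⟨
  (n / o ∸ m / o) ℕ.* o                                  ∎
  where open ≡-Reasoning

coprime-*ʳ : ∀ {k m n} → Coprime k m → Coprime k n → Coprime k (m ℕ.* n)
coprime-*ʳ k⊥m k⊥n (d∣k , d∣mn) =
  k⊥n (d∣k , coprime-divisor (λ (e∣d , e∣m) → k⊥m (∣-trans e∣d d∣k , e∣m)) d∣mn)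

coprime-^ʳ : ∀ {k m} n → Coprime k m → Coprime k (m ^ n)
coprime-^ʳ ℕ.zero  k⊥m = ∣1⇒≡1 ∘ proj₂
coprime-^ʳ (suc n) k⊥m = coprime-*ʳ k⊥m (coprime-^ʳ n k⊥m)

pos-^ : ∀ m n → + (m ^ n) ≡ (+ m) ℤ.^ n
pos-^ m ℕ.zero  = refl
pos-^ m (suc n) = trans (ℤ.pos-* m (m ^ n)) (cong (+ m *_) (pos-^ m n))

⟨⟩-least : ∀ {A B : Pred ℕ 0ℓ} → A ⊆ ⟨ B ⟩ → ⟨ A ⟩ ⊆ ⟨ B ⟩
⟨⟩-least A⊆ (gen a)   = A⊆ a
⟨⟩-least A⊆ zero      = zero
⟨⟩-least A⊆ (add p q) = add (⟨⟩-least A⊆ p) (⟨⟩-least A⊆ q)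

⟨⟩-* : ∀ {A x} k → ⟨ A ⟩ x → ⟨ A ⟩ (k ℕ.* x)
⟨⟩-* ℕ.zero  p = zero
⟨⟩-* (suc k) p = add p (⟨⟩-* k p)

-- In a derivation of such an `x` every `add` has a zero summand, so following the other summand
-- must end at a `gen`. This places irreducible elements in every generating set.
irreducible⇒generator : ∀ {A x} → ⟨ A ⟩ x → x ≢ 0 →
  (∀ {y z} → ⟨ A ⟩ y → ⟨ A ⟩ z → y ≢ 0 → z ≢ 0 → y ℕ.+ z ≢ x) → A x
irreducible⇒generator (gen a) x≢0 irr = a
irreducible⇒generator zero    x≢0 irr = contradiction refl x≢0
irreducible⇒generator {A} (add {y} {z} p q) x≢0 irr with y ≟ 0 | z ≟ 0
... | yes refl | _        = irreducible⇒generator q x≢0 irr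
... | no _     | yes refl = subst A (sym (+-identityʳ y))
  (irreducible⇒generator p (x≢0 ∘ trans (+-identityʳ y))
    (λ u v u≢0 v≢0 eq → irr u v u≢0 v≢0 (trans eq (sym (+-identityʳ y)))))
... | no y≢0   | no z≢0   = contradiction refl (irr p q y≢0 z≢0)

-- Submonoids generated by a strictly increasing sequence.

module IncreasingGenerators
  (A : Pred ℕ 0ℓ) (s : ℕ → ℕ)
  (s∈A : ∀ j → A (s j)) (A⇒s : ∀ {x} → A x → ∃[ j ] x ≡ s j)
  (0<s₀ : 0 ℕ.< s 0) (s-step : ∀ j → s j ℕ.< s (suc j))
  where

  s-mono-< : ∀ {i j} → i ℕ.< j → s i ℕ.< s j
  s-mono-< {i} {suc j} (s≤s i≤j) with m≤n⇒m<n∨m≡n i≤j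
  ... | inj₁ i<j  = <-trans (s-mono-< i<j) (s-step j)
  ... | inj₂ refl = s-step j

  s-mono-≤ : ∀ {i j} → i ≤ j → s i ≤ s j
  s-mono-≤ i≤j with m≤n⇒m<n∨m≡n i≤j
  ... | inj₁ i<j  = <⇒≤ (s-mono-< i<j)
  ... | inj₂ refl = ≤-refl

  s-cancel-< : ∀ {i j} → s i ℕ.< s j → i ℕ.< j
  s-cancel-< sᵢ<sⱼ = ≰⇒> (<⇒≱ sᵢ<sⱼ ∘ s-mono-≤)

  0<s : ∀ j → 0 ℕ.< s j
  0<s j = <-≤-trans 0<s₀ (s-mono-≤ z≤n)

  -- Makes the search for a summand `s j` of `x` finite: only `j < x` can occur.
  index<s : ∀ j → j ℕ.< s j
  index<s ℕ.zero  = 0<s₀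
  index<s (suc j) = ≤-<-trans (index<s j) (s-step j)

  peel : ∀ {x} → ⟨ A ⟩ x → x ≡ 0 ⊎ (∃[ j ] ∃[ y ] ⟨ A ⟩ y × s j ℕ.+ y ≡ x)
  peel (gen a) with j , refl ← A⇒s a = inj₂ (j , 0 , zero , +-identityʳ _)
  peel zero = inj₁ refl
  peel (add {x} {z} p q) with peel p
  ... | inj₁ refl                 = peel q
  ... | inj₂ (j , y , y∈ , refl) = inj₂ (j , y ℕ.+ z , add y∈ q , sym (+-assoc (s j) y z))

  -- By `peel`, a nonzero `x` is a member iff some `x ∸ s j` is, and this is smaller because
  -- `0 < s j`. Decidability is what allows a least reducible index to be found constructively.
  ∈⟨A⟩? : Decidable ⟨ A ⟩
  ∈⟨A⟩? x = go x (<-wellFounded x)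
    where
    go : ∀ x → Acc ℕ._<_ x → Dec (⟨ A ⟩ x)
    go x (acc rec) = map′ to from
      ((x ≟ 0) ⊎-dec anyUpTo? split? x)
      where
      split? : Decidable (λ j → s j ≤ x × ⟨ A ⟩ (x ∸ s j))
      split? j with s j ≤? x
      ... | no ¬le = no (¬le ∘ proj₁)
      ... | yes le = map′ (le ,_) proj₂ (go (x ∸ s j) (rec (∸-monoʳ-< (0<s j) le)))

      to : _ → ⟨ A ⟩ x
      to (inj₁ refl)               = zero
      to (inj₂ (j , _ , le , rest)) = subst ⟨ A ⟩ (m+[n∸m]≡n le) (add (gen (s∈A j)) rest)

      from : ⟨ A ⟩ x → _
      from p with peel p
      ... | inj₁ x≡0 = inj₁ x≡0
      ... | inj₂ (j , y , y∈ , refl) = inj₂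
        (j , <-≤-trans (index<s j) (m≤m+n (s j) y) , m≤m+n (s j) y ,
         subst ⟨ A ⟩ (sym (m+n∸m≡n (s j) y)) y∈)

  -- The truncated subtraction is exact, since `i < j` gives `s i < s j`.
  Reducible : Pred ℕ 0ℓ
  Reducible j = ∃[ i ] i ℕ.< j × ⟨ A ⟩ (s j ∸ s i)

  reducible? : Decidable Reducible
  reducible? j = anyUpTo? (λ i → ∈⟨A⟩? (s j ∸ s i)) j

  reducible-exists : ∃[ j ] Reducible j
  -- Of the `suc (s 0)` values at indices up to `s 0`, two share a residue; their difference is a
  -- multiple of the generator `s 0`.
  reducible-exists with pigeonhole ≤-refl (λ (i : Fin (suc (s 0))) → residue (toℕ i))
    where
    instance _ = >-nonZero 0<s₀
    residue : ℕ → Fin (s 0)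
    residue k = s k mod s 0
  ... | i , j , i<j , eq = toℕ j , toℕ i , i<j ,
    subst ⟨ A ⟩ (sym (%-≡⇒∸-multiple (s (toℕ i)) (s (toℕ j)) (s 0) %-eq))
      (⟨⟩-* (s (toℕ j) / s 0 ∸ s (toℕ i) / s 0) (gen (s∈A 0)))
    where
    instance _ = >-nonZero 0<s₀
    toℕ-mod : ∀ k → toℕ (k mod s 0) ≡ k % s 0
    toℕ-mod k = toℕ-fromℕ< (m%n<n k (s 0))
    %-eq : s (toℕ i) % s 0 ≡ s (toℕ j) % s 0
    %-eq = trans (sym (toℕ-mod (s (toℕ i)))) (trans (cong toℕ eq) (toℕ-mod (s (toℕ j))))

  -- Peeling a generator `s i` off the nonzero first summand leaves `s j ∸ s i` as a sum of two
  -- members; the nonzero `z` forces `s i < s j`, hence `i < j`.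
  sum⇒reducible : ∀ {j y z} → ⟨ A ⟩ y → ⟨ A ⟩ z → y ≢ 0 → z ≢ 0 → y ℕ.+ z ≡ s j → Reducible j
  sum⇒reducible {j} {_} {z} p q y≢0 z≢0 eq with peel p
  ... | inj₁ y≡0 = contradiction y≡0 y≢0
  ... | inj₂ (i , y , y∈ , refl) = i , s-cancel-< sᵢ<sⱼ , subst ⟨ A ⟩ y+z≡ (add y∈ q)
    where
    assoc-eq : s i ℕ.+ (y ℕ.+ z) ≡ s j
    assoc-eq = trans (sym (+-assoc (s i) y z)) eq

    sᵢ<sⱼ : s i ℕ.< s j
    sᵢ<sⱼ = <-≤-trans (m<m+n (s i) (n≢0⇒n>0 (z≢0 ∘ m+n≡0⇒n≡0 y))) (≤-reflexive assoc-eq)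

    y+z≡ : y ℕ.+ z ≡ s j ∸ s i
    y+z≡ = trans (sym (m+n∸m≡n (s i) (y ℕ.+ z))) (cong (_∸ s i) assoc-eq)

  -- A subtraction-free way to say that `s (k+1) - a * s k` does not depend on `k`.
  module _ (a : ℕ) (recurrence : ∀ i k → s (suc k) ℕ.+ a ℕ.* s i ≡ a ℕ.* s k ℕ.+ s (suc i)) where

    reducible-suc : ∀ {j} → Reducible j → Reducible (suc j)
    reducible-suc {j} (i , i<j , y∈) = suc i , s<s i<j , subst ⟨ A ⟩ (sym ay≡) (⟨⟩-* a y∈)
      where
      open ≡-Reasoning
      ay≡ : s (suc j) ∸ s (suc i) ≡ a ℕ.* (s j ∸ s i)
      ay≡ = begin
        s (suc j) ∸ s (suc i)
          -- Adding `a * s i` on both sides of the subtraction creates the left side of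
          -- `recurrence`.
          ≡⟨ [m+n]∸[m+o]≡n∸o (a ℕ.* s i) _ _ ⟨
        (a ℕ.* s i ℕ.+ s (suc j)) ∸ (a ℕ.* s i ℕ.+ s (suc i))
          ≡⟨ cong₂ _∸_ (trans (+-comm (a ℕ.* s i) _) (trans (recurrence i j) (+-comm (a ℕ.* s j) _)))
                       (+-comm (a ℕ.* s i) _) ⟩
        (s (suc i) ℕ.+ a ℕ.* s j) ∸ (s (suc i) ℕ.+ a ℕ.* s i)
          ≡⟨ [m+n]∸[m+o]≡n∸o (s (suc i)) _ _ ⟩
        a ℕ.* s j ∸ a ℕ.* s i
          ≡⟨ *-distribˡ-∸ a (s j) (s i) ⟨
        a ℕ.* (s j ∸ s i)
          ∎

    reducible-≤ : ∀ {i j} → i ≤ j → Reducible i → Reducible j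
    reducible-≤ {j = j} i≤j r with m≤n⇒m<n∨m≡n i≤j
    ... | inj₂ refl             = r
    ... | inj₁ (s≤s i≤j′) = reducible-suc (reducible-≤ i≤j′ r)

    e-least-reducible : ∀ {p} → Reducible p → (∀ i → i ℕ.< p → ¬ Reducible i) → e[ ⟨ A ⟩ ]≡ p
    e-least-reducible {p} red min =
      G , ((⟨⟩-least G⊆⟨A⟩ , ⟨⟩-least A⊆⟨G⟩) , G-minimal) ,
      applyUpTo s p ,
      applyUpTo⁺₁ s p (λ i<j _ → <⇒≢ (s-mono-< i<j)) ,
      (∈-applyUpTo⁻ s , λ { (j , j<p , refl) → ∈-applyUpTo⁺ s j<p }) ,
      length-applyUpTo s p
      where
      G : Pred ℕ 0ℓ
      G x = ∃[ j ] j ℕ.< p × x ≡ s j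

      G⊆⟨A⟩ : G ⊆ ⟨ A ⟩
      G⊆⟨A⟩ (j , _ , refl) = gen (s∈A j)

      -- A sum smaller than `s j` involves only generators smaller than `s j`, thus of index below
      -- `j`, which the induction hypothesis covers.
      below : ∀ {j x} → (∀ {k} → k ℕ.< j → ⟨ G ⟩ (s k)) → ⟨ A ⟩ x → x ℕ.< s j → ⟨ G ⟩ x
      below ih (gen a) x<sⱼ with k , refl ← A⇒s a = ih (s-cancel-< x<sⱼ)
      below ih zero x<sⱼ = zero
      below ih (add {x} {y} u v) x+y<sⱼ =
        add (below ih u (≤-<-trans (m≤m+n x y) x+y<sⱼ)) (below ih v (≤-<-trans (m≤n+m y x) x+y<sⱼ))

      s∈⟨G⟩ : ∀ j → ⟨ G ⟩ (s j)
      s∈⟨G⟩ = <-rec _ step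
        where
        step : ∀ j → (∀ {k} → k ℕ.< j → ⟨ G ⟩ (s k)) → ⟨ G ⟩ (s j)
        step j ih with p ≤? j
        ... | no p≰j  = gen (j , ≰⇒> p≰j , refl)
        -- Reducibility propagates from `p` up to `j`, so `s j` splits as `s i` plus a remainder
        -- that is below `s j` because `s i` is positive.
        ... | yes p≤j with i , i<j , y∈ ← reducible-≤ p≤j red =
          subst ⟨ G ⟩ (m+[n∸m]≡n sᵢ≤sⱼ) (add (ih i<j) (below ih y∈ (∸-monoʳ-< (0<s i) sᵢ≤sⱼ)))
          where
          sᵢ≤sⱼ : s i ≤ s j
          sᵢ≤sⱼ = <⇒≤ (s-mono-< i<j)

      A⊆⟨G⟩ : A ⊆ ⟨ G ⟩
      A⊆⟨G⟩ a with j , refl ← A⇒s a = s∈⟨G⟩ j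

      -- For `j < p`, writing `s j` as a sum of two nonzero members would make `j` reducible,
      -- against the minimality of `p`.
      G-minimal : ∀ (B : Pred ℕ 0ℓ) → B Generates ⟨ A ⟩ → G ⊆ B
      G-minimal B (B⊆ , ⊆B) (j , j<p , refl) =
        irreducible⇒generator (⊆B (gen (s∈A j))) (m<n⇒n≢0 (0<s j))
          (λ u v u≢0 v≢0 eq → min j j<p (sum⇒reducible (B⊆ u) (B⊆ v) u≢0 v≢0 eq))

    e-exists : ∃[ p ] e[ ⟨ A ⟩ ]≡ p × Reducible p
    e-exists with least reducible? (proj₂ reducible-exists)
    ... | p , red , min = p , e-least-reducible red min , red

-- Generators of the form E aʲ - d and the size of reducible ones.

module ShiftedPowers
  (a E : ℕ) (d : ℤ) (2≤a : 2 ≤ a) (0<E : 0 ℕ.< E) (E⊥d : ℤ.Coprime (+ E) d)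
  (A : Pred ℕ 0ℓ) (s : ℕ → ℕ)
  (s≡ : ∀ j → + s j ≡ + E * + (a ^ j) ℤ.- d)
  (s∈A : ∀ j → A (s j)) (A⇒s : ∀ {x} → A x → ∃[ j ] x ≡ s j)
  (0<s₀ : 0 ℕ.< s 0)
  where

  private instance
    E≢0 : NonZero E
    E≢0 = >-nonZero 0<E

    a≢0 : NonZero a
    a≢0 = >-nonZero (<-≤-trans (s<s z≤n) 2≤a)

    +E-positive : ℤ.Positive (+ E)
    +E-positive = ℤ.positive (ℤ.+<+ 0<E)

  s-step : ∀ j → s j ℕ.< s (suc j)
  s-step j = ℤ.drop‿+<+ (begin-strict
    + s j                            ≡⟨ s≡ j ⟩
    + E * + (a ^ j) ℤ.- d            <⟨ ℤ.+-monoˡ-< (ℤ.- d) (ℤ.*-monoˡ-<-pos (+ E) (ℤ.+<+ (^-monoʳ-< a 2≤a (n<1+n j)))) ⟩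
    + E * + (a ^ suc j) ℤ.- d        ≡⟨ s≡ (suc j) ⟨
    + s (suc j)                      ∎)
    where open ℤ.≤-Reasoning

  recurrence : ∀ i k → s (suc k) ℕ.+ a ℕ.* s i ≡ a ℕ.* s k ℕ.+ s (suc i)
  recurrence i k = ℤ.+-injective (begin
    + (s (suc k) ℕ.+ a ℕ.* s i)                            ≡⟨ expand k i ⟩
    -- Once expanded, the expression is symmetric in `i` and `k`.
    (+ E * (+ a * x k) ℤ.- d) ℤ.+ + a * (+ E * x i ℤ.- d)  ≡⟨ identity (+ E) (+ a) (x k) (x i) d ⟩
    (+ E * (+ a * x i) ℤ.- d) ℤ.+ + a * (+ E * x k ℤ.- d)  ≡⟨ expand i k ⟨
    + (s (suc i) ℕ.+ a ℕ.* s k)                            ≡⟨ cong +_ (+-comm (s (suc i)) (a ℕ.* s k)) ⟩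
    + (a ℕ.* s k ℕ.+ s (suc i))                            ∎)
    where
    open ≡-Reasoning
    x : ℕ → ℤ
    x j = + (a ^ j)

    expand : ∀ j k → + (s (suc j) ℕ.+ a ℕ.* s k) ≡ (+ E * (+ a * x j) ℤ.- d) ℤ.+ + a * (+ E * x k ℤ.- d)
    expand j k = cong₂ ℤ._+_
      (trans (s≡ (suc j)) (cong (λ u → + E * u ℤ.- d) (ℤ.pos-* a (a ^ j))))
      (trans (ℤ.pos-* a (s k)) (cong (+ a *_) (s≡ k)))

    identity : ∀ e a x y d → (e * (a * x) ℤ.- d) ℤ.+ a * (e * y ℤ.- d) ≡ (e * (a * y) ℤ.- d) ℤ.+ a * (e * x ℤ.- d)
    identity = ℤ-Solver.solve-∀

  open IncreasingGenerators A s s∈A A⇒s 0<s₀ s-step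

  -- L is the number of generators in a representation of y.
  generator-count : ∀ {y} → ⟨ A ⟩ y → ∃[ L ] ∃[ X ]
    + y ℤ.+ + L * d ≡ + E * X × L ℕ.* s 0 ≤ y × (L ≡ 0 → y ≡ 0)
  generator-count (gen p) with j , refl ← A⇒s p =
    1 , + (a ^ j) , trans (cong (ℤ._+ 1ℤ * d) (s≡ j)) (identity _ d) ,
    ≤-trans (≤-reflexive (+-identityʳ (s 0))) (s-mono-≤ z≤n) , λ ()
    where
    identity : ∀ u d → (u ℤ.- d) ℤ.+ 1ℤ * d ≡ u
    identity = ℤ-Solver.solve-∀
  generator-count zero = 0 , 0ℤ , sym (ℤ.*-zeroʳ (+ E)) , z≤n , λ _ → refl
  generator-count (add {y} {z} p q)
    with L , X , eq , le , nz ← generator-count p | M , Y , eq′ , le′ , nz′ ← generator-count q =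
    L ℕ.+ M , X ℤ.+ Y ,
    trans (identity (+ y) (+ z) (+ L) (+ M) d) (trans (cong₂ ℤ._+_ eq eq′) (sym (ℤ.*-distribˡ-+ (+ E) X Y))) ,
    ≤-trans (≤-reflexive (*-distribʳ-+ (s 0) L M)) (+-mono-≤ le le′) ,
    λ L+M≡0 → cong₂ ℕ._+_ (nz (m+n≡0⇒m≡0 L L+M≡0)) (nz′ (m+n≡0⇒n≡0 L L+M≡0))
    where
    identity : ∀ y z L M d → (y ℤ.+ z) ℤ.+ (L ℤ.+ M) * d ≡ (y ℤ.+ L * d) ℤ.+ (z ℤ.+ M * d)
    identity = ℤ-Solver.solve-∀

  -- Modulo `E` every generator is `- d`, so a difference of two generators is 0 while a sum of `L`
  -- generators is `- L * d`. Coprimality gives `E ∣ L`, and each of the `L` summands is at least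
  -- `s 0`.
  difference≥E*s₀ : ∀ {i j} → i ℕ.< j → ⟨ A ⟩ (s j ∸ s i) → E ℕ.* s 0 ≤ s j ∸ s i
  difference≥E*s₀ {i} {j} i<j y∈ with L , X , eq , L*s₀≤y , L≡0⇒ ← generator-count y∈ =
    ≤-trans (*-monoˡ-≤ (s 0) E≤L) L*s₀≤y
    where
    sᵢ<sⱼ : s i ℕ.< s j
    sᵢ<sⱼ = s-mono-< i<j

    y : ℕ
    y = s j ∸ s i

    -- The cofactor of `E` in `d * L`. It may be negative, so the divisibility is passed on through
    -- absolute values.
    Δ : ℤ
    Δ = X ℤ.+ + (a ^ i) ℤ.- + (a ^ j)

    open ≡-Reasoning

    d*L≡ : d * + L ≡ Δ * + E
    d*L≡ = begin
      d * + L
        ≡⟨ isolate (+ y) (+ s i) (+ L) d ⟩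
      (+ y ℤ.+ + L * d) ℤ.+ + s i ℤ.- + (s i ℕ.+ y)
        ≡⟨ cong (λ z → (+ y ℤ.+ + L * d) ℤ.+ + s i ℤ.- + z) (m+[n∸m]≡n (<⇒≤ sᵢ<sⱼ)) ⟩
      (+ y ℤ.+ + L * d) ℤ.+ + s i ℤ.- + s j
        ≡⟨ cong₂ ℤ._-_ (cong₂ ℤ._+_ eq (s≡ i)) (s≡ j) ⟩
      + E * X ℤ.+ (+ E * + (a ^ i) ℤ.- d) ℤ.- (+ E * + (a ^ j) ℤ.- d)
        ≡⟨ collect (+ E) X (+ (a ^ i)) (+ (a ^ j)) d ⟩
      Δ * + E
        ∎
      where
      isolate : ∀ y u L d → d * L ≡ (y ℤ.+ L * d) ℤ.+ u ℤ.- (u ℤ.+ y)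
      isolate = ℤ-Solver.solve-∀
      collect : ∀ e X x y d → e * X ℤ.+ (e * x ℤ.- d) ℤ.- (e * y ℤ.- d) ≡ (X ℤ.+ x ℤ.- y) * e
      collect = ℤ-Solver.solve-∀

    E∣L : E ∣ L
    E∣L = ℤ.coprime-divisor (+ E) d (+ L) E⊥d
      (divides ℤ.∣ Δ ∣ (trans (cong ℤ.∣_∣ d*L≡) (ℤ.abs-* Δ (+ E))))

    E≤L : E ≤ L
    -- `L` is nonzero, as an empty sum would contradict `s i < s j`.
    E≤L = ∣⇒≤ {{ℕ.≢-nonZero (λ L≡0 → m<n⇒n≢0 (m<n⇒0<n∸m sᵢ<sⱼ) (L≡0⇒ L≡0))}} E∣L

  -- The bound `s j ≥ (1 + E) * s 0` becomes `E * a ^ j ≥ E * (1 + s 0)` after adding `d`, because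
  -- `s 0 + d = E`; then `E` cancels.
  reducible⇒s₀<a^ : ∀ {j} → Reducible j → s 0 ℕ.< a ^ j
  reducible⇒s₀<a^ {j} (i , i<j , y∈) =
    ℤ.drop‿+≤+ (ℤ.*-cancelˡ-≤-pos (+ suc (s 0)) (+ (a ^ j)) (+ E) (begin
      + E * + suc (s 0)                          ≡⟨ regroup (+ E) (+ s 0) d ⟩
      (+ E * 1ℤ ℤ.- d) ℤ.+ + E * + s 0 ℤ.+ d      ≡⟨ cong₂ (λ u v → u ℤ.+ v ℤ.+ d) (sym (s≡ 0)) (sym (ℤ.pos-* E (s 0))) ⟩
      + (s 0 ℕ.+ E ℕ.* s 0) ℤ.+ d                ≤⟨ ℤ.+-monoˡ-≤ d (ℤ.+≤+ s₀+Es₀≤sⱼ) ⟩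
      + s j ℤ.+ d                                ≡⟨ cong (ℤ._+ d) (s≡ j) ⟩
      + E * + (a ^ j) ℤ.- d ℤ.+ d                ≡⟨ cancel (+ E * + (a ^ j)) d ⟩
      + E * + (a ^ j)                            ∎))
    where
    open ℤ.≤-Reasoning
    s₀+Es₀≤sⱼ : s 0 ℕ.+ E ℕ.* s 0 ≤ s j
    s₀+Es₀≤sⱼ = ≤-trans (+-mono-≤ (s-mono-≤ z≤n) (difference≥E*s₀ i<j y∈))
                  (≤-reflexive (m+[n∸m]≡n (<⇒≤ (s-mono-< i<j))))
    regroup : ∀ e x d → e * (1ℤ ℤ.+ x) ≡ (e * 1ℤ ℤ.- d) ℤ.+ e * x ℤ.+ d
    regroup = ℤ-Solver.solve-∀
    cancel : ∀ u d → u ℤ.- d ℤ.+ d ≡ u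
    cancel = ℤ-Solver.solve-∀

  e-bound : ∃[ p ] e[ ⟨ A ⟩ ]≡ p × s 0 ℕ.< a ^ p
  e-bound = map₂ (map₂ reducible⇒s₀<a^) (e-exists a recurrence)

-- Specialisation to the generators c aⁿ⁺ʲ - d.

q≤e*q-d : ∀ {e d} q → 0 ℕ.< e → 0 ℕ.< q → d < + e → + q ≤ℤ + (e ℕ.* q) ℤ.- d
q≤e*q-d {e} {d} (suc q) 0<e _ d<e = begin
  1ℤ ℤ.+ + q                                    ≤⟨ ℤ.+-monoʳ-≤ 1ℤ (ℤ.+≤+ (m≤n*m q e)) ⟩
  1ℤ ℤ.+ + (e ℕ.* q)                            ≡⟨ ℤ.+-comm 1ℤ (+ (e ℕ.* q)) ⟩
  -- One of the `suc q` copies of `e` absorbs `d`, leaving at least 1.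
  + (e ℕ.* q) ℤ.+ 1ℤ                            ≤⟨ ℤ.+-monoʳ-≤ (+ (e ℕ.* q)) 1≤e-d ⟩
  + (e ℕ.* q) ℤ.+ (+ e ℤ.- d)                   ≡⟨ identity (+ (e ℕ.* q)) (+ e) d ⟩
  + (e ℕ.+ e ℕ.* q) ℤ.- d                       ≡⟨ cong (λ u → + u ℤ.- d) (*-suc e q) ⟨
  + (e ℕ.* suc q) ℤ.- d                         ∎
  where
  open ℤ.≤-Reasoning
  instance _ = >-nonZero 0<e
  1≤e-d : 1ℤ ≤ℤ + e ℤ.- d
  1≤e-d = ℤ.i<j⇒suc[i]≤j (subst (_< + e ℤ.- d) (ℤ.+-inverseʳ d) (ℤ.+-monoˡ-< (ℤ.- d) d<e))
  identity : ∀ u e d → u ℤ.+ (e ℤ.- d) ≡ (e ℤ.+ u) ℤ.- d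
  identity = ℤ-Solver.solve-∀

theorem3p6 : ∀ (a c d : ℤ) → + 2 ≤ℤ a → 0ℤ < c → d < c * a →
    gcd d a ≡ 1ℤ → gcd d c ≡ 1ℤ →
    ∀ (n : ℕ) → 1 ≤ n → ∃[ k ] (e[ S a c d n ]≡ k × n ≤ k)
theorem3p6 (+ a) (+ c) d (ℤ.+≤+ 2≤a) (ℤ.+<+ 0<c) d<ca d⊥a d⊥c n@(suc m) _ =
  -- With `n = suc m`, the goal is `m < p`: if `p ≤ m`, then `a ^ p ≤ a ^ m ≤ s 0`, contradicting
  -- `s 0 < a ^ p`.
  map₂ (map₂ λ s₀<aᵖ → ≰⇒> λ p≤m → <⇒≱ s₀<aᵖ (≤-trans (^-monoʳ-≤ a p≤m) aᵐ≤s₀)) e-bound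
  where
  0<a : 0 ℕ.< a
  0<a = <-≤-trans (s<s z≤n) 2≤a

  instance _ = >-nonZero 0<a

  e E : ℕ
  e = c ℕ.* a
  E = c ℕ.* a ^ n

  0<e : 0 ℕ.< e
  0<e = *-mono-< 0<c 0<a

  d<e : d < + e
  d<e = subst (d <_) (sym (ℤ.pos-* c a)) d<ca

  value : ℕ → ℤ
  value j = + E * + (a ^ j) ℤ.- d

  -- One factor `a` moves from `a ^ n` to `c`, since the hypothesis compares `d` with `e = c * a`;
  -- this is where `1 ≤ n` enters.
  power≡ : ∀ j → + E * + (a ^ j) ≡ + (e ℕ.* a ^ (m ℕ.+ j))
  power≡ j = trans (sym (ℤ.pos-* E (a ^ j))) (cong +_ (begin
    c ℕ.* (a ℕ.* a ^ m) ℕ.* a ^ j        ≡⟨ identity c a (a ^ m) (a ^ j) ⟩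
    c ℕ.* a ℕ.* (a ^ m ℕ.* a ^ j)        ≡⟨ cong (e ℕ.*_) (^-distribˡ-+-* a m j) ⟨
    e ℕ.* a ^ (m ℕ.+ j)                  ∎))
    where
    open ≡-Reasoning
    identity : ∀ c a x y → c ℕ.* (a ℕ.* x) ℕ.* y ≡ c ℕ.* a ℕ.* (x ℕ.* y)
    identity = ℕ-Solver.solve-∀

  power≤value : ∀ j → + (a ^ (m ℕ.+ j)) ≤ℤ value j
  power≤value j = subst (λ u → + (a ^ (m ℕ.+ j)) ≤ℤ u ℤ.- d) (sym (power≡ j))
    (q≤e*q-d (a ^ (m ℕ.+ j)) 0<e (m^n>0 a (m ℕ.+ j)) d<e)

  -- The absolute value only changes the type: `value j` is positive by `power≤value`.
  s : ℕ → ℕ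
  s j = ℤ.∣ value j ∣

  s≡ : ∀ j → + s j ≡ value j
  s≡ j = ℤ.0≤i⇒+∣i∣≡i (ℤ.≤-trans (ℤ.+≤+ z≤n) (power≤value j))

  aᵐ⁺ʲ≤s : ∀ j → a ^ (m ℕ.+ j) ≤ s j
  aᵐ⁺ʲ≤s j = ℤ.drop‿+≤+ (subst (+ (a ^ (m ℕ.+ j)) ≤ℤ_) (sym (s≡ j)) (power≤value j))

  aᵐ≤s₀ : a ^ m ≤ s 0
  aᵐ≤s₀ = subst (λ k → a ^ k ≤ s 0) (+-identityʳ m) (aᵐ⁺ʲ≤s 0)

  value≡ : ∀ j → value j ≡ + c * (+ a) ℤ.^ (n ℕ.+ j) ℤ.- d
  value≡ j = cong (ℤ._- d) (begin
    + E * + (a ^ j)                     ≡⟨ ℤ.pos-* E (a ^ j) ⟨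
    + (c ℕ.* a ^ n ℕ.* a ^ j)           ≡⟨ cong +_ (trans (*-assoc c (a ^ n) (a ^ j)) (cong (c ℕ.*_) (sym (^-distribˡ-+-* a n j)))) ⟩
    + (c ℕ.* a ^ (n ℕ.+ j))             ≡⟨ ℤ.pos-* c (a ^ (n ℕ.+ j)) ⟩
    + c * + (a ^ (n ℕ.+ j))             ≡⟨ cong (+ c *_) (pos-^ a (n ℕ.+ j)) ⟩
    + c * (+ a) ℤ.^ (n ℕ.+ j)           ∎)
    where open ≡-Reasoning

  E⊥d : ℤ.Coprime (+ E) d
  E⊥d = Coprimality.sym (coprime-*ʳ (gcd≡1⇒coprime (ℤ.+-injective d⊥c))
                                    (coprime-^ʳ n (gcd≡1⇒coprime (ℤ.+-injective d⊥a))))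

  open ShiftedPowers a E d 2≤a (*-mono-< 0<c (m^n>0 a n)) E⊥d (generators (+ a) (+ c) d n) s s≡
    (λ j → j , trans (s≡ j) (value≡ j))
    (λ (j , eq) → j , ℤ.+-injective (trans eq (sym (trans (s≡ j) (value≡ j)))))
    (<-≤-trans (m^n>0 a m) aᵐ≤s₀)
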